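{- Let $G$ be a connected, triangle-free graph with domination number $\gamma(G)\le 3$. Then $G$ is well-dominated if and only if $G$ is isomorphic to one of the eleven graphs $K_1$, $K_2$, $P_4$, $C_4$, $C_5$, $C_7$, $P_3\circ K_1$, $H_1$, $H_2$, $H_3$, $H_4$.
   Context: All graphs are finite and simple. A set $D\subseteq V(G)$ is a dominating set of $G$ if every vertex of $G$ is in $D$ or adjacent to a vertex of $D$. The domination number $\gamma(G)$ is the minimum cardinality of a dominating set. A graph is well-dominated if all of its minimal (with respect to inclusion) dominating sets have the same cardinality. $P_n$, $C_n$, $K_n$ denote the path, cycle and complete graph on $n$ vertices. The corona $F\circ K_1$ is formed from $F$ by adding, for each vertex of $F$, a single new vertex of degree $1$ adjacent to it. The graphs $H_1,\dots,H_4$ have vertex set $\{1,\dots,7\}$ and edge sets: $E(H_1)=\{12,13,25,36,56,47,67\}$ (a $5$-cycle with a pendant path of length $2$ attached); $E(H_2)=E(H_1)\cup\{17\}$; $E(H_3)=E(H_1)\cup\{34\}$ (a $5$-cycle and a $4$-cycle sharing exactly one edge); $E(H_4)=E(H_1)\cup\{34,17\}$. -}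

module Defs where

open import Data.Empty using (⊥)
open import Data.Fin using (Fin; toℕ; splitAt)
open import Data.Fin.Properties using (all?; any?; _≟_)
open import Data.Fin.Subset using (Subset; _∈_; _⊆_; ∣_∣; ⊤)
open import Data.Fin.Subset.Properties using (anySubset?; _∈?_; ∈⊤)
open import Data.List using (List; []; _∷_)
import Data.List.Membership.Propositional as List
import Data.List.Membership.DecPropositional as DecMembership
open import Data.Nat.Base as ℕ using (ℕ; zero; suc; _+_; _≤_; _%_; NonZero; z≤n; s≤s)
import Data.Nat.Properties as ℕ
open import Data.Product using (Σ; _×_; _,_; ∃; proj₁)
open import Data.Product.Properties using (≡-dec)
open import Data.Sum using (_⊎_; inj₁; inj₂; swap)
open import Function using (_∘_)
open import Function.Bundles using (_↔_; _⇔_; Inverse)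
open import Level using (0ℓ)
open import Relation.Binary using (Rel; Decidable; Symmetric; Irreflexive)
open import Relation.Binary.Construct.Closure.ReflexiveTransitive using (Star)
open import Relation.Binary.PropositionalEquality
  using (_≡_; _≢_; refl; sym)
open import Relation.Nullary using (¬_; yes; no; contradiction; ¬?)
open import Relation.Nullary.Decidable using (_×-dec_; _⊎-dec_)
import Relation.Unary as U

-- A finite simple graph with vertex set Fin n.
record Graph (n : ℕ) : Set₁ where
  field
    Adj    : Rel (Fin n) 0ℓ
    adj?   : Decidable Adj
    symm   : Symmetric Adj
    irrefl : Irreflexive _≡_ Adj

open Graph public

infix 4 _≅_

_≅_ : ∀ {m n} → Graph m → Graph n → Set
_≅_ {m} {n} G H =
  Σ (Fin m ↔ Fin n) λ f →
    ∀ u v → Adj G u v ⇔ Adj H (Inverse.to f u) (Inverse.to f v)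

-- The graph on zero vertices is not connected.
Connected : ∀ {n} → Graph n → Set
Connected {n} G = NonZero n × (∀ u v → Star (Adj G) u v)

TriangleFree : ∀ {n} → Graph n → Set
TriangleFree G = ∀ u v w → ¬ (Adj G u v × Adj G v w × Adj G w u)

Dominating : ∀ {n} → Graph n → Subset n → Set
Dominating G D = ∀ v → v ∈ D ⊎ ∃ λ u → u ∈ D × Adj G v u

MinimalDominating : ∀ {n} → Graph n → Subset n → Set
MinimalDominating G D =
  Dominating G D × (∀ D′ → Dominating G D′ → D′ ⊆ D → D′ ≡ D)

WellDominated : ∀ {n} → Graph n → Set
WellDominated G =
  ∀ D D′ → MinimalDominating G D → MinimalDominating G D′ → ∣ D ∣ ≡ ∣ D′ ∣

IsMinimum : (ℕ → Set) → ℕ → Set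
IsMinimum P k = P k × (∀ j → P j → k ≤ j)

minimum : {P : ℕ → Set} → U.Decidable P → ∀ m → P m → ∃ (IsMinimum P)
minimum P? zero p = zero , p , λ _ _ → z≤n
minimum {P} P? (suc m) p with P? zero
... | yes p₀ = zero , p₀ , λ _ _ → z≤n
... | no ¬p₀ with minimum {P ∘ suc} (P? ∘ suc) m p
...   | k , q , least = suc k , q , λ where
  zero    r → contradiction r ¬p₀
  (suc j) r → s≤s (least j r)

DominatingSize : ∀ {n} → Graph n → ℕ → Set
DominatingSize G k = ∃ λ D → Dominating G D × ∣ D ∣ ≡ k

dominating? : ∀ {n} (G : Graph n) → U.Decidable (Dominating G)
dominating? G D =
  all? λ v → (v ∈? D) ⊎-dec any? λ u → (u ∈? D) ×-dec adj? G v u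

γ-minimum : ∀ {n} (G : Graph n) → ∃ (IsMinimum (DominatingSize G))
γ-minimum {n} G =
  minimum (λ k → anySubset? λ D → dominating? G D ×-dec (∣ D ∣ ℕ.≟ k))
          ∣ ⊤ {n} ∣ (⊤ , (λ _ → inj₁ ∈⊤) , refl)

γ : ∀ {n} → Graph n → ℕ
γ G = proj₁ (γ-minimum G)

-- The simple graph underlying an arbitrary relation: orientation and loops
-- are discarded.
fromRel : ∀ {n} (R : Rel (Fin n) 0ℓ) → Decidable R → Graph n
fromRel R R? = record
  { Adj    = λ u v → u ≢ v × (R u v ⊎ R v u)
  ; adj?   = λ u v → ¬? (u ≟ v) ×-dec (R? u v ⊎-dec R? v u)
  ; symm   = λ (u≢v , r) → u≢v ∘ sym , swap r
  ; irrefl = λ u≡v (u≢v , _) → u≢v u≡v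
  }

K : ∀ n → Graph n
K n = record
  { Adj    = _≢_
  ; adj?   = λ u v → ¬? (u ≟ v)
  ; symm   = λ u≢v → u≢v ∘ sym
  ; irrefl = λ u≡v u≢v → u≢v u≡v
  }

P : ∀ n → Graph n
P n = fromRel (λ u v → toℕ v ≡ suc (toℕ u)) (λ u v → toℕ v ℕ.≟ suc (toℕ u))

-- The n-cycle when 3 ≤ n.
C : ∀ n .⦃ _ : NonZero n ⦄ → Graph n
C n = fromRel (λ u v → toℕ v ≡ suc (toℕ u) % n)
              (λ u v → toℕ v ℕ.≟ suc (toℕ u) % n)

-- In Fin (n + n), the first n vertices are those of F and the last n are
-- the added leaves, in the same order.
module Corona {n} (F : Graph n) where

  CAdj : Rel (Fin n ⊎ Fin n) 0ℓ
  CAdj (inj₁ u) (inj₁ v) = Adj F u v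
  CAdj (inj₁ u) (inj₂ v) = u ≡ v
  CAdj (inj₂ u) (inj₁ v) = u ≡ v
  CAdj (inj₂ u) (inj₂ v) = ⊥

  cadj? : Decidable CAdj
  cadj? (inj₁ u) (inj₁ v) = adj? F u v
  cadj? (inj₁ u) (inj₂ v) = u ≟ v
  cadj? (inj₂ u) (inj₁ v) = u ≟ v
  cadj? (inj₂ u) (inj₂ v) = no λ ()

  csymm : Symmetric CAdj
  csymm {inj₁ u} {inj₁ v} = symm F
  csymm {inj₁ u} {inj₂ v} = sym
  csymm {inj₂ u} {inj₁ v} = sym

  cirrefl : ∀ x → ¬ CAdj x x
  cirrefl (inj₁ u) = irrefl F refl

_∘K₁ : ∀ {n} → Graph n → Graph (n + n)
_∘K₁ {n} F = record
  { Adj    = λ u v → CAdj (splitAt n u) (splitAt n v)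
  ; adj?   = λ u v → cadj? (splitAt n u) (splitAt n v)
  ; symm   = λ {u} {v} → csymm {splitAt n u} {splitAt n v}
  ; irrefl = λ { {u} refl → cirrefl (splitAt n u) }
  }
  where open Corona F

-- The graph on Fin n in which i : Fin n carries the label 1 + i, with edges
-- given as pairs of labels.
fromEdges : ∀ n → List (ℕ × ℕ) → Graph n
fromEdges n E = fromRel (λ u v → (label u , label v) List.∈ E)
                        (λ u v → (label u , label v) ∈E? E)
  where
  label : Fin n → ℕ
  label i = suc (toℕ i)
  open DecMembership (≡-dec ℕ._≟_ ℕ._≟_) renaming (_∈?_ to _∈E?_)

E₁ : List (ℕ × ℕ)
E₁ = (1 , 2) ∷ (1 , 3) ∷ (2 , 5) ∷ (3 , 6) ∷ (5 , 6) ∷ (4 , 7) ∷ (6 , 7) ∷ []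

H₁ H₂ H₃ H₄ : Graph 7
H₁ = fromEdges 7 E₁
H₂ = fromEdges 7 ((1 , 7) ∷ E₁)
H₃ = fromEdges 7 ((3 , 4) ∷ E₁)
H₄ = fromEdges 7 ((3 , 4) ∷ (1 , 7) ∷ E₁)

{-# OPTIONS --safe #-}

-- If G is well-dominated, then every independent set extends to a maximal
-- independent set, which is a minimal dominating set and hence has γ(G)
-- elements; so G has no independent set of more than 3 vertices.  The
-- triangle-free graphs with this property form a hereditary class, in which a
-- graph with n + 1 vertices is a one-vertex extension of a graph with n
-- vertices.  Generating them in this way, up to isomorphism, stops at 8
-- vertices, since R(3,4) = 9, after only 48 graphs, and these can be inspected.

module Submission where

open import Data.Bool.Base using (Bool; true; false; T; not; _∧_; if_then_else_)
open import Data.Bool.ListAction using (all)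
import Data.Bool.Properties as Bool
open import Data.Bool.Properties using (T?; T-≡)
open import Data.Empty using (⊥-elim) renaming (⊥ to Empty)
open import Data.Fin using (Fin; zero; suc; punchIn)
open import Data.Fin.Permutation as Perm
  using (Permutation; _⟨$⟩ʳ_; _⟨$⟩ˡ_; inverseˡ; inverseʳ; insert; lift₀)
open import Data.Fin.Properties using (any?; all?; ¬∀⟶∃¬)
open import Data.Fin.Subset
  using (Subset; inside; outside; _∈_; _∉_; _⊆_; _⊃_; ∣_∣; ⊤; ⊥; ⁅_⁆; _∪_; _─_; _-_)
open import Data.Fin.Subset.Induction using (Acc; acc; ⊃-wellFounded)
open import Data.Fin.Subset.Properties
open import Data.List.Base as List
  using (List; []; _∷_; _++_; allFin; upTo; concatMap; filterᵇ; deduplicateᵇ)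
open import Data.List.Membership.Propositional as List using ()
open import Data.List.Membership.Propositional.Properties using (∈-++⁺ˡ; ∈-++⁺ʳ; ∈-map⁺; ∈-filter⁺; ∈-upTo⁺)
open import Data.List.Properties using (≡-dec; ∷-injective)
open import Data.List.Relation.Unary.All as All using (All)
open import Data.List.Relation.Unary.All.Properties using (all⁺)
open import Data.List.Relation.Unary.Any as Any using (Any; here; there)
open import Data.List.Relation.Unary.Any.Properties using (concatMap⁺; deduplicate⁺)
open import Data.Maybe.Base as Maybe using (Maybe; just; nothing; is-just; is-nothing; _<∣>_)
open import Data.Nat using (ℕ; zero; suc; _≤_; s≤s; _≤′_; ≤′-reflexive; ≤′-step)
open import Data.Nat.Properties as ℕ using (≤-trans; ≤-reflexive)
open import Data.Product using (Σ; ∃; _×_; _,_; proj₁; proj₂)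
open import Data.Sum using (_⊎_; inj₁; inj₂)
open import Data.Unit using (tt)
open import Data.Vec.Base using (Vec; []; _∷_; lookup; tabulate; zipWith; removeAt; here; there)
open import Data.Vec.Properties using (lookup-zipWith; lookup∘tabulate; []=⇒lookup; lookup⇒[]=)
open import Function using (_∘_; id; mk⇔; Equivalence)
open import Function.Bundles using (_⇔_)
open import Function.Construct.Composition using (_⇔-∘_)
open import Relation.Binary.Construct.Closure.ReflexiveTransitive using (Star; ε; _◅_; gmap)
open import Relation.Binary.PropositionalEquality
  using (_≡_; refl; sym; trans; cong; subst; subst₂; module ≡-Reasoning)
open import Relation.Nullary using (¬_; Dec; yes; no; contradiction; ¬?)
open import Relation.Nullary.Decidable
  using (isYes; toWitness; fromWitness; decidable-stable; map′; dec⇒maybe; _×-dec_; _⊎-dec_; _→-dec_)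
open import Algebra.Properties.CommutativeMonoid.Sum ℕ.+-0-commutativeMonoid
  using () renaming (sum to ∑; sum-permute to ∑-permute; sum-cong-≗ to ∑-cong)
open import Defs

private
  variable
    m n : ℕ

-- Isomorphisms

≅-sym : (G : Graph m) (H : Graph n) → G ≅ H → H ≅ G
≅-sym G H (π , π-adj) = Perm.flip π , λ u v → mk⇔
  (λ a → Equivalence.from (π-adj _ _) (subst₂ (Adj H) (sym (inverseʳ π)) (sym (inverseʳ π)) a))
  (λ a → subst₂ (Adj H) (inverseʳ π) (inverseʳ π) (Equivalence.to (π-adj _ _) a))

≅-trans : ∀ {l} (F : Graph l) (G : Graph m) (H : Graph n) → F ≅ G → G ≅ H → F ≅ H
≅-trans F G H (π , π-adj) (ρ , ρ-adj) =
  π Perm.∘ₚ ρ , λ u v → ρ-adj (π ⟨$⟩ʳ u) (π ⟨$⟩ʳ v) ⇔-∘ π-adj u v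

preimage : Permutation m n → Subset n → Subset m
preimage π D = tabulate (lookup D ∘ (π ⟨$⟩ʳ_))

module _ (π : Permutation m n) {D : Subset n} where

  ∈-preimage⁺ : ∀ {u} → π ⟨$⟩ʳ u ∈ D → u ∈ preimage π D
  ∈-preimage⁺ {u} p = lookup⇒[]= u _ (trans (lookup∘tabulate _ u) ([]=⇒lookup p))

  ∈-preimage⁻ : ∀ {u} → u ∈ preimage π D → π ⟨$⟩ʳ u ∈ D
  ∈-preimage⁻ {u} p = lookup⇒[]= _ D (trans (sym (lookup∘tabulate _ u)) ([]=⇒lookup p))

indicator : Subset n → Fin n → ℕ
indicator p u = if lookup p u then 1 else 0

-- As a sum, cardinality inherits the invariance of finite sums under permutation; `∣preimage∣`
-- rests on this.
∣p∣≡sum : (p : Subset n) → ∣ p ∣ ≡ ∑ (indicator p)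
∣p∣≡sum []            = refl
∣p∣≡sum (inside  ∷ p) = cong suc (∣p∣≡sum p)
∣p∣≡sum (outside ∷ p) = ∣p∣≡sum p

∣preimage∣ : (π : Permutation m n) (D : Subset n) → ∣ preimage π D ∣ ≡ ∣ D ∣
∣preimage∣ π D = begin
  ∣ preimage π D ∣              ≡⟨ ∣p∣≡sum (preimage π D) ⟩
  ∑ (indicator (preimage π D))  ≡⟨ ∑-cong (cong (if_then 1 else 0) ∘ lookup∘tabulate (lookup D ∘ (π ⟨$⟩ʳ_))) ⟩
  ∑ (indicator D ∘ (π ⟨$⟩ʳ_))   ≡⟨ ∑-permute (indicator D) π ⟨
  ∑ (indicator D)               ≡⟨ ∣p∣≡sum D ⟨
  ∣ D ∣                         ∎
  where open ≡-Reasoning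

Dominating-preimage : (G : Graph m) (H : Graph n) ((π , _) : G ≅ H) {D : Subset n} →
  Dominating H D → Dominating G (preimage π D)
Dominating-preimage G H (π , π-adj) dom v with dom (π ⟨$⟩ʳ v)
... | inj₁ πv∈D           = inj₁ (∈-preimage⁺ π πv∈D)
... | inj₂ (u , u∈D , a) = inj₂
  ( π ⟨$⟩ˡ u
  , ∈-preimage⁺ π (subst (_∈ _) (sym (inverseʳ π)) u∈D)
  , Equivalence.from (π-adj _ _) (subst (Adj H _) (sym (inverseʳ π)) a)
  )

MinimalDominating-preimage : (G : Graph m) (H : Graph n) ((π , _) : G ≅ H) {D : Subset n} →
  MinimalDominating H D → MinimalDominating G (preimage π D)
MinimalDominating-preimage G H G≅H@(π , _) {D} (dom , min) =
  Dominating-preimage G H G≅H dom , λ D′ dom′ D′⊆ →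
    -- `D′` is carried to `H` along the inverse of `π`, where the minimality of `D` applies.
    let D″≡D = min (preimage (Perm.flip π) D′)
                   (Dominating-preimage H G (≅-sym G H G≅H) dom′)
                   (λ v∈ → subst (_∈ D) (inverseʳ π) (∈-preimage⁻ π (D′⊆ (∈-preimage⁻ (Perm.flip π) v∈))))
    in ⊆-antisym D′⊆ λ {u} u∈ → subst (_∈ D′) (inverseˡ π)
         (∈-preimage⁻ (Perm.flip π) (subst (_ ∈_) (sym D″≡D) (∈-preimage⁻ π u∈)))

WellDominated-resp-≅ : (G : Graph m) (H : Graph n) → G ≅ H → WellDominated G → WellDominated H
WellDominated-resp-≅ G H G≅H@(π , _) wd D D′ min min′ =
  trans (sym (∣preimage∣ π D))
    (trans (wd _ _ (MinimalDominating-preimage G H G≅H min)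
                   (MinimalDominating-preimage G H G≅H min′))
           (∣preimage∣ π D′))

-- Domination and independence

Independent : Graph n → Subset n → Set
Independent G I = ∀ u v → u ∈ I → v ∈ I → ¬ Adj G u v

Independent-preimage : (G : Graph m) (H : Graph n) ((π , _) : G ≅ H) {I : Subset n} →
  Independent H I → Independent G (preimage π I)
Independent-preimage G H (π , π-adj) ind u v u∈ v∈ =
  ind _ _ (∈-preimage⁻ π u∈) (∈-preimage⁻ π v∈) ∘ Equivalence.to (π-adj u v)

module _ (G : Graph n) where

  Dominating-mono : ∀ {D E} → D ⊆ E → Dominating G D → Dominating G E
  Dominating-mono D⊆E dom v with dom v
  ... | inj₁ v∈D           = inj₁ (D⊆E v∈D)
  ... | inj₂ (u , u∈D , a) = inj₂ (u , D⊆E u∈D , a)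

  -- Domination passes to supersets, so a dominating set is minimal as soon as no single vertex can
  -- be removed. This replaces a test of all subsets of `D`.
  minimalDominating? : ∀ D → Dec (MinimalDominating G D)
  minimalDominating? D = map′ to from
    (dominating? G D ×-dec all? λ v → (v ∈? D) →-dec ¬? (dominating? G (D - v)))
    where
    to : Dominating G D × (∀ v → v ∈ D → ¬ Dominating G (D - v)) → MinimalDominating G D
    to (dom , crit) = dom , λ D′ dom′ D′⊆D → ⊆-antisym D′⊆D λ {v} v∈D →
      decidable-stable (v ∈? D′) λ v∉D′ → crit v v∈D
        (Dominating-mono (λ x∈D′ → x∈p∧x≢y⇒x∈p-y (D′⊆D x∈D′) λ { refl → v∉D′ x∈D′ }) dom′)

    from : MinimalDominating G D → Dominating G D × (∀ v → v ∈ D → ¬ Dominating G (D - v))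
    from (dom , min) = dom , λ v v∈D dom′ →
      ℕ.<-irrefl (cong ∣_∣ (min (D - v) dom′ (p─q⊆p D ⁅ v ⁆))) (x∈p⇒∣p-x∣<∣p∣ v∈D)

  -- A vertex that `I` fails to dominate is neither in `I` nor adjacent to it, so adding it
  -- preserves independence. In a finite graph this growth must stop.
  independentDominating : ∀ {I} → Acc _⊃_ I → Independent G I →
    ∃ λ M → I ⊆ M × Independent G M × Dominating G M
  independentDominating {I} (acc rec) ind with dominating? G I
  ... | yes dom = I , id , ind , dom
  ... | no ¬dom with ¬∀⟶∃¬ n _ (λ v → (v ∈? I) ⊎-dec any? λ u → (u ∈? I) ×-dec adj? G v u) ¬dom
  ...   | v , free =
    let M , J⊆M , rest = independentDominating (rec I⊂J) ind′ in M , J⊆M ∘ p⊆p∪q ⁅ v ⁆ , rest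
    where
    J = I ∪ ⁅ v ⁆

    I⊂J : J ⊃ I
    I⊂J = p⊆p∪q ⁅ v ⁆ , v , q⊆p∪q I ⁅ v ⁆ (x∈⁅x⁆ v) , free ∘ inj₁

    ind′ : Independent G J
    ind′ x y x∈J y∈J a with x∈p∪q⁻ I ⁅ v ⁆ x∈J | x∈p∪q⁻ I ⁅ v ⁆ y∈J
    ... | inj₁ x∈I | inj₁ y∈I = ind x y x∈I y∈I a
    ... | inj₁ x∈I | inj₂ y∈v with refl ← x∈⁅y⁆⇒x≡y v y∈v = free (inj₂ (x , x∈I , symm G a))
    ... | inj₂ x∈v | inj₁ y∈I with refl ← x∈⁅y⁆⇒x≡y v x∈v = free (inj₂ (y , y∈I , a))
    ... | inj₂ x∈v | inj₂ y∈v = irrefl G (trans (x∈⁅y⁆⇒x≡y v x∈v) (sym (x∈⁅y⁆⇒x≡y v y∈v))) a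

  -- The neighbours of a vertex of `M` lie outside `M`, so inside `M` that vertex is dominated by
  -- itself alone.
  independentDominating⇒minimal : ∀ {M} → Independent G M → Dominating G M → MinimalDominating G M
  independentDominating⇒minimal {M} ind dom = dom , λ D dom′ D⊆M → ⊆-antisym D⊆M λ {v} v∈M →
    case-dom D⊆M v∈M (dom′ v)
    where
    case-dom : ∀ {D v} → D ⊆ M → v ∈ M → v ∈ D ⊎ ∃ (λ u → u ∈ D × Adj G v u) → v ∈ D
    case-dom D⊆M v∈M (inj₁ v∈D)           = v∈D
    case-dom D⊆M v∈M (inj₂ (u , u∈D , a)) = contradiction a (ind _ u v∈M (D⊆M u∈D))

  -- A dominating proper subset of a smallest dominating set would be smaller still.
  γ-attained : ∃ λ D → MinimalDominating G D × ∣ D ∣ ≡ γ G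
  γ-attained with γ-minimum G
  ... | k , (D , dom , ∣D∣≡k) , least = D , (dom , min) , ∣D∣≡k
    where
    min : ∀ D′ → Dominating G D′ → D′ ⊆ D → D′ ≡ D
    min D′ dom′ D′⊆D = ⊆-antisym D′⊆D λ {v} v∈D → decidable-stable (v ∈? D′) λ v∉D′ →
      ℕ.<⇒≱ (p⊂q⇒∣p∣<∣q∣ (D′⊆D , v , v∈D , v∉D′))
            (≤-trans (≤-reflexive ∣D∣≡k) (least _ (D′ , dom′ , refl)))

  ofSize? : ∀ k → Dec (∀ D → MinimalDominating G D → ∣ D ∣ ≡ k)
  ofSize? k = map′
    (λ none D min → decidable-stable (∣ D ∣ ℕ.≟ k) λ ≢k → none (D , ≢k , min))
    (λ all (D , ≢k , min) → ≢k (all D min))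
    (¬? (anySubset? λ D → ¬? (∣ D ∣ ℕ.≟ k) ×-dec minimalDominating? D))

  -- Some minimal dominating set has size `γ G`, so comparing every other one with this number
  -- suffices: one pass over subsets instead of a pass over pairs.
  wellDominated? : Dec (WellDominated G)
  wellDominated? = map′
    (λ all D D′ min min′ → trans (all D min) (sym (all D′ min′)))
    (λ wd D min → let D′ , min′ , ∣D′∣≡γ = γ-attained in trans (wd D D′ min min′) ∣D′∣≡γ)
    (ofSize? (γ G))

  wellDominated⇒independent≤γ : WellDominated G → ∀ I → Independent G I → ∣ I ∣ ≤ γ G
  wellDominated⇒independent≤γ wd I ind =
    let M , I⊆M , ind′ , dom = independentDominating (⊃-wellFounded I) ind
        D , min , ∣D∣≡γ      = γ-attained
    in ≤-trans (p⊆q⇒∣p∣≤∣q∣ I⊆M)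
         (≤-reflexive (trans (wd M D (independentDominating⇒minimal ind′ dom) min) ∣D∣≡γ))

  -- A certificate of disconnectedness that a finite search can find: a walk that starts in `S`
  -- never leaves it.
  Cut : Subset n → Set
  Cut S = ∃ (_∈ S) × ∃ (_∉ S) × (∀ u → u ∈ S → ∀ v → Adj G u v → v ∈ S)

  cut? : Dec (∃ Cut)
  cut? = anySubset? λ S → any? (_∈? S) ×-dec any? (λ v → ¬? (v ∈? S)) ×-dec
    all? λ u → (u ∈? S) →-dec all? λ v → adj? G u v →-dec (v ∈? S)

  connected⇒uncut : (∀ u v → Star (Adj G) u v) → ¬ ∃ Cut
  connected⇒uncut conn (S , (u , u∈S) , (v , v∉S) , closed) = v∉S (reach u∈S (conn u v))
    where
    reach : ∀ {x y} → x ∈ S → Star (Adj G) x y → y ∈ S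
    reach x∈S ε        = x∈S
    reach x∈S (a ◅ as) = reach (closed _ x∈S _ a) as

-- Codes of graphs

infixr 5 _◂_

-- An adjacency matrix reduced to its upper triangle: each row gives the neighbours of a vertex
-- among the later ones. Such plain data can be enumerated and evaluated.
data Code : ℕ → Set where
  []  : Code 0
  _◂_ : Subset n → Code n → Code (suc n)

adj : Code n → Fin n → Fin n → Bool
adj (S ◂ c) zero    zero    = false
adj (S ◂ c) zero    (suc v) = lookup S v
adj (S ◂ c) (suc u) zero    = lookup S u
adj (S ◂ c) (suc u) (suc v) = adj c u v

adj-sym : (c : Code n) → ∀ u v → adj c u v ≡ adj c v u
adj-sym (S ◂ c) zero    zero    = refl
adj-sym (S ◂ c) zero    (suc v) = refl
adj-sym (S ◂ c) (suc u) zero    = refl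
adj-sym (S ◂ c) (suc u) (suc v) = adj-sym c u v

adj-irrefl : (c : Code n) → ∀ u → adj c u u ≡ false
adj-irrefl (S ◂ c) zero    = refl
adj-irrefl (S ◂ c) (suc u) = adj-irrefl c u

⟦_⟧ : Code n → Graph n
⟦ c ⟧ = record
  { Adj    = λ u v → T (adj c u v)
  ; adj?   = λ u v → T? (adj c u v)
  ; symm   = λ {u} {v} → subst T (adj-sym c u v)
  ; irrefl = λ { {u} refl → subst T (adj-irrefl c u) }
  }

tail : Graph (suc n) → Graph n
tail G = record
  { Adj    = λ u v → Adj G (suc u) (suc v)
  ; adj?   = λ u v → adj? G (suc u) (suc v)
  ; symm   = symm G
  ; irrefl = irrefl G ∘ cong suc
  }

module _ (G : Graph (suc n)) (c : Code n) (G′≅c : tail G ≅ ⟦ c ⟧) where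

  private
    π : Permutation n n
    π = proj₁ G′≅c

  neighbours₀ : Subset n
  neighbours₀ = tabulate λ v → isYes (adj? G zero (suc (π ⟨$⟩ˡ v)))

  neighbours₀-spec : ∀ v → Adj G zero (suc v) ⇔ T (lookup neighbours₀ (π ⟨$⟩ʳ v))
  neighbours₀-spec v rewrite lookup∘tabulate (λ v → isYes (adj? G zero (suc (π ⟨$⟩ˡ v)))) (π ⟨$⟩ʳ v)
                           | inverseˡ π {v} = mk⇔ fromWitness toWitness

  -- Restoring vertex zero to a coded remainder: its neighbourhood only has to be renamed along `π`.
  -- Both `encode` and the completeness of the catalogue proceed this way.
  ≅-extend : G ≅ ⟦ neighbours₀ ◂ c ⟧
  ≅-extend = lift₀ π , λ where
    zero    zero    → mk⇔ (irrefl G refl) λ ()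
    zero    (suc v) → neighbours₀-spec v
    (suc u) zero    → mk⇔ (Equivalence.to (neighbours₀-spec u) ∘ symm G)
                          (symm G ∘ Equivalence.from (neighbours₀-spec u))
    (suc u) (suc v) → proj₂ G′≅c u v

encode : (G : Graph n) → Σ (Code n) λ c → G ≅ ⟦ c ⟧
encode {zero}  G = [] , Perm.id , λ ()
encode {suc n} G with encode (tail G)
... | c , G′≅c = neighbours₀ G c G′≅c ◂ c , ≅-extend G c G′≅c

-- Search for an isomorphism

-- The neighbourhood of a vertex, indexed by the vertices that remain after its deletion; `punchIn`
-- leads back to the old numbering.
link : Code (suc n) → Fin (suc n) → Subset n
link         (S ◂ c) zero    = S
link {suc n} (S ◂ c) (suc i) = lookup S i ∷ link c i

delete : Code (suc n) → Fin (suc n) → Code n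
delete         (S ◂ c) zero    = c
delete {suc n} (S ◂ c) (suc i) = removeAt S i ◂ delete c i

lookup-link : ∀ (c : Code (suc n)) i j → lookup (link c i) j ≡ adj c i (punchIn i j)
lookup-link         (S ◂ c) zero    j       = refl
lookup-link {suc n} (S ◂ c) (suc i) zero    = refl
lookup-link {suc n} (S ◂ c) (suc i) (suc j) = lookup-link c i j

lookup-removeAt : ∀ {a} {A : Set a} (xs : Vec A (suc n)) i j →
  lookup (removeAt xs i) j ≡ lookup xs (punchIn i j)
lookup-removeAt (x ∷ xs)         zero    j       = refl
lookup-removeAt (x ∷ xs@(_ ∷ _)) (suc i) zero    = refl
lookup-removeAt (x ∷ xs@(_ ∷ _)) (suc i) (suc j) = lookup-removeAt xs i j

adj-delete : ∀ (c : Code (suc n)) i j k → adj (delete c i) j k ≡ adj c (punchIn i j) (punchIn i k)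
adj-delete         (S ◂ c) zero    j       k       = refl
adj-delete {suc n} (S ◂ c) (suc i) zero    zero    = refl
adj-delete {suc n} (S ◂ c) (suc i) zero    (suc k) = lookup-removeAt S i k
adj-delete {suc n} (S ◂ c) (suc i) (suc j) zero    = lookup-removeAt S i j
adj-delete {suc n} (S ◂ c) (suc i) (suc j) (suc k) = adj-delete c i j k

-- The colour of a vertex records its adjacency to the vertices that have
-- already been matched and removed, so matching equal colours preserves edges.
Colouring : ℕ → Set
Colouring = Vec (List Bool)

ColouredIso : Code m → Colouring m → Code n → Colouring n → Set
ColouredIso {m} {n} c k d l = Σ (Permutation m n) λ π →
  (∀ u v → adj d (π ⟨$⟩ʳ u) (π ⟨$⟩ʳ v) ≡ adj c u v) ×
  (∀ u → lookup l (π ⟨$⟩ʳ u) ≡ lookup k u)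

refine : Subset n → Colouring n → Colouring n
refine = zipWith _∷_

module _ {S : Subset m} {c : Code m} {x : List Bool} {k : Colouring m}
         (d : Code (suc n)) (l : Colouring (suc n)) (i : Fin (suc n)) (lᵢ≡x : lookup l i ≡ x)
         (rest : ColouredIso c (refine S k) (delete d i) (refine (link d i) (removeAt l i)))
         where

  private
    π : Permutation m n
    π = proj₁ rest

    ρ : Permutation (suc m) (suc n)
    ρ = insert zero i π

    -- Equality of refined colours holds two facts: the heads give adjacency to the pair just
    -- matched, the tails agreement of the earlier colours.
    colour≡ : ∀ u → lookup (link d i) (π ⟨$⟩ʳ u) ∷ lookup (removeAt l i) (π ⟨$⟩ʳ u)
                      ≡ lookup S u ∷ lookup k u
    colour≡ u = trans (sym (lookup-zipWith _∷_ (π ⟨$⟩ʳ u) (link d i) (removeAt l i)))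
                      (trans (proj₂ (proj₂ rest) u) (lookup-zipWith _∷_ u S k))

    link≡ : ∀ u → adj d i (punchIn i (π ⟨$⟩ʳ u)) ≡ lookup S u
    link≡ u = trans (sym (lookup-link d i (π ⟨$⟩ʳ u))) (proj₁ (∷-injective (colour≡ u)))

    ρ-adj : ∀ u v → adj d (ρ ⟨$⟩ʳ u) (ρ ⟨$⟩ʳ v) ≡ adj (S ◂ c) u v
    ρ-adj zero    zero    = adj-irrefl d i
    ρ-adj zero    (suc v) = link≡ v
    ρ-adj (suc u) zero    = trans (adj-sym d (punchIn i (π ⟨$⟩ʳ u)) i) (link≡ u)
    ρ-adj (suc u) (suc v) = trans (sym (adj-delete d i _ _)) (proj₁ (proj₂ rest) u v)

    ρ-col : ∀ u → lookup l (ρ ⟨$⟩ʳ u) ≡ lookup (x ∷ k) u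
    ρ-col zero    = lᵢ≡x
    ρ-col (suc u) = trans (sym (lookup-removeAt l i (π ⟨$⟩ʳ u))) (proj₂ (∷-injective (colour≡ u)))

  insertIso : ColouredIso (S ◂ c) (x ∷ k) d l
  insertIso = ρ , ρ-adj , ρ-col

search : ∀ {a p} {A : Set a} {P : A → Set p} → (∀ x → Maybe (P x)) → ∀ xs → Maybe (Any P xs)
search f []       = nothing
search f (x ∷ xs) = Maybe.map here (f x) <∣> Maybe.map there (search f xs)

-- Backtracking: the first vertex of `c` is tried against each vertex of `d` of the same colour.
-- Only success carries a proof; an overlooked isomorphism could leave a duplicate or an unsettled
-- entry, but no false result.
colouredIso? : (c : Code m) → ∀ k (d : Code n) l → Maybe (ColouredIso c k d l)
colouredIso? []      []      []          []  = just (Perm.id , (λ ()) , λ ())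
colouredIso? []      _       (_ ◂ _)     _   = nothing
colouredIso? (_ ◂ _) _       []          _   = nothing
colouredIso? (S ◂ c) (x ∷ k) d@(_ ◂ _)   l   =
  Maybe.map (proj₂ ∘ Any.satisfied) (search (λ i → via i (≡-dec Bool._≟_ (lookup l i) x)) (allFin _))
  where
  via : ∀ i → Dec (lookup l i ≡ x) → Maybe (ColouredIso (S ◂ c) (x ∷ k) d l)
  via i (no  _)    = nothing
  via i (yes lᵢ≡x) = Maybe.map (insertIso d l i lᵢ≡x)
    (colouredIso? c (refine S k) (delete d i) (refine (link d i) (removeAt l i)))

-- Starting from the degrees rather than from equal colours only prunes the search.
degrees : Code n → Colouring n
degrees c = tabulate λ u → List.replicate ∣ tabulate (adj c u) ∣ true

iso? : (c : Code m) (d : Code n) → Maybe (⟦ c ⟧ ≅ ⟦ d ⟧)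
iso? c d = Maybe.map
  (λ (π , π-adj , _) → π , λ u v → mk⇔ (subst T (sym (π-adj u v))) (subst T (π-adj u v)))
  (colouredIso? c (degrees c) d (degrees d))

witness : ∀ {a} {A : Set a} (x : Maybe A) → T (is-just x) → A
witness (just a) _ = a

all≡true : ∀ {a} {A : Set a} (p : A → Bool) xs → all p xs ≡ true → All (λ x → p x ≡ true) xs
all≡true p xs eq = All.map (Equivalence.to T-≡) (all⁺ p xs (Equivalence.from T-≡ eq))

-- The triangle-free graphs without four independent vertices

IndependentSubset : Code n → Subset n → ℕ → Set
IndependentSubset c A k = ∃ λ I → Independent ⟦ c ⟧ I × I ⊆ A × ∣ I ∣ ≡ k

x∈p─q⇒¬q[x] : ∀ (p q : Subset n) {x} → x ∈ p ─ q → ¬ T (lookup q x)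
x∈p─q⇒¬q[x] (_ ∷ p) (outside ∷ q) (there x∈) = x∈p─q⇒¬q[x] p q x∈
x∈p─q⇒¬q[x] (_ ∷ p) (inside  ∷ q) (there x∈) = x∈p─q⇒¬q[x] p q x∈

module _ {S : Subset n} {c : Code n} {A : Subset n} {k : ℕ} where

  independent-skip : ∀ {a} → IndependentSubset c A k → IndependentSubset (S ◂ c) (a ∷ A) k
  independent-skip (I , ind , I⊆A , eq) = outside ∷ I , ind′ , out⊆ I⊆A , eq
    where
    ind′ : Independent ⟦ S ◂ c ⟧ (outside ∷ I)
    ind′ (suc u) (suc v) (there u∈) (there v∈) = ind u v u∈ v∈

  independent-take : IndependentSubset c (A ─ S) k → IndependentSubset (S ◂ c) (inside ∷ A) (suc k)
  independent-take (I , ind , I⊆A─S , eq) = inside ∷ I , ind′ , s⊆s (p─q⊆p A S ∘ I⊆A─S) , cong suc eq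
    where
    ind′ : Independent ⟦ S ◂ c ⟧ (inside ∷ I)
    ind′ zero    (suc v) _          (there v∈) = x∈p─q⇒¬q[x] A S (I⊆A─S v∈)
    ind′ (suc u) zero    (there u∈) _          = x∈p─q⇒¬q[x] A S (I⊆A─S u∈)
    ind′ (suc u) (suc v) (there u∈) (there v∈) = ind u v u∈ v∈

-- Here `A` is the set of remaining candidates. The first one is either left out, or taken, in which
-- case its neighbours `S` cease to be candidates.
independentSubset? : (c : Code n) → ∀ A k → Maybe (IndependentSubset c A k)
independentSubset? {n} c A zero =
  just (⊥ , (λ _ _ u∈⊥ → ⊥-elim (∉⊥ u∈⊥)) , (λ u∈⊥ → ⊥-elim (∉⊥ u∈⊥)) , ∣⊥∣≡0 n)
independentSubset? []      []            (suc k) = nothing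
independentSubset? (S ◂ c) (outside ∷ A) (suc k) =
  Maybe.map independent-skip (independentSubset? c A (suc k))
independentSubset? (S ◂ c) (inside ∷ A)  (suc k) =
  Maybe.map independent-skip (independentSubset? c A (suc k)) <∣>
  Maybe.map independent-take (independentSubset? c (A ─ S) k)

EdgeWithin : Graph n → Subset n → Set
EdgeWithin G S = ∃ λ u → u ∈ S × ∃ λ v → v ∈ S × Adj G u v

edgeWithin? : (G : Graph n) → ∀ S → Dec (EdgeWithin G S)
edgeWithin? G S = any? λ u → (u ∈? S) ×-dec any? λ v → (v ∈? S) ×-dec adj? G u v

-- These are the Ramsey graphs for the pair (3,4).
Ramsey : Graph n → Set
Ramsey G = TriangleFree G × (∀ I → Independent G I → ∣ I ∣ ≤ 3)

Ramsey-tail : (G : Graph (suc n)) → Ramsey G → Ramsey (tail G)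
Ramsey-tail G (tf , small) =
  (λ u v w → tf (suc u) (suc v) (suc w)) , λ I ind → small (outside ∷ I) (lifted ind)
  where
  lifted : ∀ {I} → Independent (tail G) I → Independent G (outside ∷ I)
  lifted ind (suc u) (suc v) (there u∈) (there v∈) = ind u v u∈ v∈

Ramsey-resp-≅ : (G : Graph m) (H : Graph n) → G ≅ H → Ramsey G → Ramsey H
Ramsey-resp-≅ G H G≅H@(π , _) (tf , small) =
  (λ u v w (a , b , c) → tf _ _ _ (from _ _ a , from _ _ b , from _ _ c)) ,
  (λ I ind → ≤-trans (≤-reflexive (sym (∣preimage∣ π I)))
                     (small (preimage π I) (Independent-preimage G H G≅H ind)))
  where
  from : ∀ u v → Adj H u v → Adj G (π ⟨$⟩ˡ u) (π ⟨$⟩ˡ v)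
  from u v = Equivalence.to (proj₂ (≅-sym G H G≅H) u v)

-- `S` is the neighbourhood of a new vertex. An edge within `S` would close a triangle with it, and
-- three independent vertices outside `S` would make four together with it.
admissible : Code n → Subset n → Bool
admissible c S = not (isYes (edgeWithin? ⟦ c ⟧ S)) ∧ is-nothing (independentSubset? c (⊤ ─ S) 3)

Ramsey⇒admissible : (c : Code n) → ∀ S → Ramsey ⟦ S ◂ c ⟧ → T (admissible c S)
Ramsey⇒admissible c S (tf , small)
  with edgeWithin? ⟦ c ⟧ S | independentSubset? c (⊤ ─ S) 3
... | yes (u , u∈S , v , v∈S , a) | _ =
  tf zero (suc u) (suc v) (Equivalence.from T-≡ ([]=⇒lookup u∈S) , a , Equivalence.from T-≡ ([]=⇒lookup v∈S))
... | no  _ | nothing    = tt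
... | no  _ | just three =
  let I , ind , _ , ∣I∣≡4 = independent-take three
  in contradiction (small I ind) (ℕ.<⇒≱ (≤-reflexive (sym ∣I∣≡4)))

subsets : ∀ n → List (Subset n)
subsets zero    = [] ∷ []
subsets (suc n) = List.map (outside ∷_) (subsets n) ++ List.map (inside ∷_) (subsets n)

∈-subsets : (S : Subset n) → S List.∈ subsets n
∈-subsets []            = here refl
∈-subsets (outside ∷ S) = ∈-++⁺ˡ (∈-map⁺ (outside ∷_) (∈-subsets S))
∈-subsets (inside  ∷ S) = ∈-++⁺ʳ _ (∈-map⁺ (inside ∷_) (∈-subsets S))

extensions : Code n → List (Code (suc n))
extensions {n} c = List.map (_◂ c) (filterᵇ (admissible c) (subsets n))

isomorphic : Code n → Code n → Bool
isomorphic c d = is-just (iso? c d)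

extendAll : List (Code n) → List (Code (suc n))
extendAll = deduplicateᵇ isomorphic ∘ concatMap extensions

catalogue : ∀ n → List (Code n)
catalogue zero    = [] ∷ []
catalogue (suc n) = extendAll (catalogue n)

catalogue-complete : (G : Graph n) → Ramsey G → Any (λ c → G ≅ ⟦ c ⟧) (catalogue n)
catalogue-complete {zero}  G ram = here (Perm.id , λ ())
catalogue-complete {suc n} G ram =
  -- An entry `c` is dropped only in favour of an isomorphic `d`, which represents `G` equally well.
  deduplicate⁺ _ (λ {c} {d} d≅c G≅c → ≅-trans G ⟦ c ⟧ ⟦ d ⟧ G≅c (≅-sym ⟦ d ⟧ ⟦ c ⟧ (witness (iso? d c) d≅c)))
    (concatMap⁺ extensions (Any.map extend (catalogue-complete (tail G) (Ramsey-tail G ram))))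
  where
  extend : ∀ {c} → tail G ≅ ⟦ c ⟧ → Any (λ d → G ≅ ⟦ d ⟧) (extensions c)
  extend {c} G′≅c = List.lose (∈-map⁺ (_◂ c) (∈-filter⁺ (T? ∘ admissible c) (∈-subsets S)
      (Ramsey⇒admissible c S (Ramsey-resp-≅ G ⟦ S ◂ c ⟧ G≅ ram)))) G≅
    where
    S  = neighbours₀ G c G′≅c
    G≅ = ≅-extend G c G′≅c

-- Inspection of the catalogue

targets : List (∃ Graph)
targets = (_ , K 1) ∷ (_ , K 2) ∷ (_ , P 4) ∷ (_ , C 4) ∷ (_ , C 5) ∷ (_ , C 7) ∷
          (_ , P 3 ∘K₁) ∷ (_ , H₁) ∷ (_ , H₂) ∷ (_ , H₃) ∷ (_ , H₄) ∷ []

Listed : Graph n → Set₁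
Listed G = Any (λ (_ , H) → G ≅ H) targets

listed? : (c : Code n) → Maybe (Listed ⟦ c ⟧)
listed? c = search (λ (_ , H) → let d , H≅d = encode H in
  Maybe.map (λ c≅d → ≅-trans ⟦ c ⟧ ⟦ d ⟧ H c≅d (≅-sym H ⟦ d ⟧ H≅d)) (iso? c d)) targets

Classified : Graph n → Set₁
Classified G = (∀ u v → Star (Adj G) u v) → WellDominated G → Listed G

Classified-resp-≅ : (G : Graph m) (H : Graph n) → G ≅ H → Classified H → Classified G
Classified-resp-≅ G H G≅H@(π , π-adj) classified conn wd =
  Any.map (λ {(_ , L)} → ≅-trans G H L G≅H) (classified conn′ (WellDominated-resp-≅ G H G≅H wd))
  where
  conn′ : ∀ u v → Star (Adj H) u v
  conn′ u v = subst₂ (Star _) (inverseʳ π) (inverseʳ π)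
    (gmap (π ⟨$⟩ʳ_) (Equivalence.to (π-adj _ _)) (conn (π ⟨$⟩ˡ u) (π ⟨$⟩ˡ v)))

-- An entry is settled by being one of the eleven graphs, or vacuously, by having a cut or by
-- failing to be well-dominated.
classify : (c : Code n) → Maybe (Classified ⟦ c ⟧)
classify c =
  Maybe.map (λ listed _ _ → listed) (listed? c) <∣>
  Maybe.map (λ cut conn → contradiction cut (connected⇒uncut ⟦ c ⟧ conn)) (dec⇒maybe (cut? ⟦ c ⟧)) <∣>
  Maybe.map (λ ¬wd _ wd → contradiction wd ¬wd) (dec⇒maybe (¬? (wellDominated? ⟦ c ⟧)))

-- At nine vertices the list evaluates to `[]`, which is the bound R(3,4) ≤ 9; beyond that there is
-- nothing left to extend.
catalogue-empty : ∀ {n} → 9 ≤′ n → catalogue n ≡ []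
catalogue-empty (≤′-reflexive refl) = refl
catalogue-empty (≤′-step 9≤n)       = cong extendAll (catalogue-empty 9≤n)

-- The shift by one leaves out the empty graph, which meets the hypotheses of `Classified` vacuously
-- but is not listed.
settled : ℕ → Bool
settled n = all (is-just ∘ classify) (catalogue (suc n))

settled-<8 : all settled (upTo 8) ≡ true
-- The inspection of all entries on 1 to 8 vertices happens here, by evaluation.
settled-<8 = refl

catalogue-classified : ∀ n → All (λ c → Classified ⟦ c ⟧) (catalogue (suc n))
catalogue-classified n with n ℕ.<? 8
... | yes n<8 = All.map (λ {c} eq → witness (classify c) (Equivalence.from T-≡ eq))
  (all≡true (is-just ∘ classify) _ (All.lookup (all≡true settled (upTo 8) settled-<8) (∈-upTo⁺ n<8)))
... | no  n≮8 = subst (All _) (sym (catalogue-empty (ℕ.≤⇒≤′ (s≤s (ℕ.≮⇒≥ n≮8))))) All.[]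

-- No target has more than seven vertices, so evaluation can run through all of its vertex subsets.
targets-checked : all (λ (_ , H) → isYes (wellDominated? H)) targets ≡ true
targets-checked = refl

targets-wellDominated : All (λ (_ , H) → WellDominated H) targets
targets-wellDominated = All.map (λ eq → toWitness (Equivalence.from T-≡ eq))
  (all≡true (λ (_ , H) → isYes (wellDominated? H)) targets targets-checked)

-- The two directions of the equivalence

wellDominated⇒listed : (G : Graph n) → Connected G → TriangleFree G → γ G ≤ 3 → WellDominated G → Listed G
wellDominated⇒listed {zero}  G (() , _)
wellDominated⇒listed {suc n} G (_ , conn) tf γ≤3 wd =
  All.lookupWith (λ {c} classified G≅c → Classified-resp-≅ G ⟦ c ⟧ G≅c classified)
    (catalogue-classified n)
    (catalogue-complete G (tf , λ I ind → ≤-trans (wellDominated⇒independent≤γ G wd I ind) γ≤3))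
    conn wd

listed⇒wellDominated : (G : Graph n) → Listed G → WellDominated G
listed⇒wellDominated G listed =
  let wd , G≅H = All.lookupAny targets-wellDominated listed
      H        = proj₂ (Any.lookup listed)
  in WellDominated-resp-≅ H G (≅-sym G H G≅H) wd

-- The separate singleton case avoids a trailing `Empty`, so that over `targets` this unfolds to
-- exactly the disjunction of eleven isomorphisms.
⋁ : List Set → Set
⋁ []           = Empty
⋁ (A ∷ [])     = A
⋁ (A ∷ B ∷ As) = A ⊎ ⋁ (B ∷ As)

Any⇔⋁ : ∀ {a} {A : Set a} {P : A → Set} xs → Any P xs ⇔ ⋁ (List.map P xs)
Any⇔⋁ xs = mk⇔ (to xs) (from xs)
  where
  to : ∀ xs → Any _ xs → ⋁ (List.map _ xs)
  to (x ∷ [])     (here p)  = p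
  to (x ∷ y ∷ xs) (here p)  = inj₁ p
  to (x ∷ y ∷ xs) (there p) = inj₂ (to (y ∷ xs) p)

  from : ∀ xs → ⋁ (List.map _ xs) → Any _ xs
  from (x ∷ [])     p        = here p
  from (x ∷ y ∷ xs) (inj₁ p) = here p
  from (x ∷ y ∷ xs) (inj₂ p) = there (from (y ∷ xs) p)

mainTheorem5 : ∀ {n : ℕ} (G : Graph n) → Connected G → TriangleFree G → γ G ≤ 3 →
    WellDominated G ⇔
    (G ≅ K 1 ⊎ G ≅ K 2 ⊎ G ≅ P 4 ⊎ G ≅ C 4 ⊎ G ≅ C 5 ⊎ G ≅ C 7 ⊎
    G ≅ (P 3 ∘K₁) ⊎ G ≅ H₁ ⊎ G ≅ H₂ ⊎ G ≅ H₃ ⊎ G ≅ H₄)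
mainTheorem5 G conn tf γ≤3 =
  Any⇔⋁ targets ⇔-∘ mk⇔ (wellDominated⇒listed G conn tf γ≤3) (listed⇒wellDominated G)
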